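{- Fix an integer base $b\ge 2$. There exists a real number $x=0.a_1a_2a_3\dots\in[0,1)$ (written in base $b$) that is \emph{not} base-$b$ normal, such that for every $k\in\mathbb{N}$ and every $\ell\in\mathbb{N}$ with $\ell\ge 2$, the number $0.a_ka_{k+\ell}a_{k+2\ell}\dots$ is base-$b$ normal.
   Context: $\mathbb{N}=\{1,2,3,\dots\}$. For $x\in[0,1)$ with base-$b$ expansion $x=0.a_1a_2a_3\dots$ (digits $a_i\in\{0,1,\dots,b-1\}$), $x$ is called (base-$b$) normal if for every $k\ge1$ and every finite string $[d_1,\dots,d_k]$ with $d_i\in\{0,1,\dots,b-1\}$, $$\lim_{n\to\infty}\frac{\#\{0\le i\le n-1: a_{i+j}=d_j \text{ for } j=1,\dots,k\}}{n}=\frac{1}{b^k}.$$ A digit sequence $0.c_1c_2c_3\dots$ is called normal if the corresponding real number (equivalently, the digit sequence, by the same frequency condition) is normal. -}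

module Defs where

open import Data.Nat using (ℕ; zero; suc; _+_; _*_; _^_; _≤_; _<_)
open import Data.Nat.Properties using (m^n≢0)
open import Data.Fin using (Fin)
open import Data.Fin.Properties using (_≟_)
open import Data.Vec using (Vec; []; _∷_)
open import Data.Integer using (+_)
open import Data.Rational using (ℚ; 0ℚ; _/_; _-_; ∣_∣) renaming (_<_ to _<ℚ_)
open import Data.Product using (Σ; ∃; _×_)
open import Relation.Nullary using (yes; no)
open import Relation.Nullary.Negation using (¬_)
open import Data.Bool using (Bool; true; false; _∧_)

-- A base-b digit sequence, 0-indexed: c i is the (i+1)-th digit after the point,
-- i.e. the number 0.c₀c₁c₂…
Digits : ℕ → Set
Digits b = ℕ → Fin b

occursAt : {b k : ℕ} → Digits b → Vec (Fin b) k → ℕ → Bool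
occursAt c []       i = true
occursAt c (d ∷ ds) i with c i ≟ d
... | yes _ = occursAt (λ j → c (suc j)) ds i
... | no  _ = false

count : {b k : ℕ} → Digits b → Vec (Fin b) k → ℕ → ℕ
count c ds zero    = zero
count c ds (suc n) with occursAt c ds n
... | true  = suc (count c ds n)
... | false = count c ds n

freq : {b k : ℕ} → Digits b → Vec (Fin b) k → ℕ → ℚ
freq c ds m = (+ count c ds (suc m)) / suc m

-- 1 / b^k  (b = 0 never occurs in use since b ≥ 2)
invPow : ℕ → ℕ → ℚ
invPow zero    k = 0ℚ
invPow (suc b) k = _/_ (+ 1) (suc b ^ k) {{m^n≢0 (suc b) k}}

_⟶_ : (ℕ → ℚ) → ℚ → Set
s ⟶ L = ∀ (ε : ℚ) → 0ℚ <ℚ ε → Σ ℕ (λ N → ∀ m → N ≤ m → ∣ s m - L ∣ <ℚ ε)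

-- base-b normality of a digit sequence (equivalently of the real 0.c₀c₁…)
Normal : (b : ℕ) → Digits b → Set
Normal b c = ∀ (k : ℕ) → 1 ≤ k → (ds : Vec (Fin b) k) →
  (λ m → freq c ds m) ⟶ invPow b k

{-# OPTIONS --safe #-}
module Submission where

-- Take a = x₀x₀x₁x₁x₂x₂… for a suitable x. No block d e d with d ≠ e occurs in a, so a is not normal.
-- A progression of step ℓ ≥ 2 never reads both copies of a digit of x, so its windows read digits of x
-- at strictly increasing places. Let x run, for s = 0, 1, 2, …, many times through all words of length s!
-- in stage s. As soon as ℓ ∣ 2·s!, the progression meets every word of a at the same offsets. A window
-- inside one word reads fixed places of it, so over a full run through the words its values are exactly
-- equidistributed, while windows leaving their word are a fraction O(1/s!) of all. Stage s starts at s
-- times the length of its run, so that an incomplete run is negligible too.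

open import Defs
open import Data.Nat using (ℕ; zero; suc; pred; _+_; _*_; _^_; _!; _∸_; _≤_; _<_; _≤?_; _<?_; z≤n; s≤s; z<s; s<s; NonZero; ∣_-_∣; ⌊_/2⌋; _/_; _%_; >-nonZero; >-nonZero⁻¹)
open import Data.Nat.Properties
open import Data.Nat.DivMod using (_mod_; m%n<n; m/n*n≡m; [m+kn]%n≡m%n; m<n⇒m%n≡m; +-distrib-/-∣ʳ; m*n/n≡m; m<n⇒m/n≡0)
open import Data.Nat.Divisibility using (_∣_; divides; ∣⇒≤; n∣m*n; ∣-trans; m∣m*n; *-pres-∣; m≤n⇒m!∣n!)
open import Data.Nat.Tactic.RingSolver using (solve-∀)
open import Data.Integer using (+_; -[1+_]; +[1+_]; _⊖_; +<+)
import Data.Integer as ℤ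
import Data.Integer.Properties as ℤ
open import Data.Rational using (mkℚ; 0ℚ; toℚᵘ; fromℚᵘ; *<*) renaming (_<_ to _<ℚ_)
import Data.Rational as ℚ
import Data.Rational.Properties as ℚ
open import Data.Rational.Unnormalised using (mkℚᵘ)
import Data.Rational.Unnormalised as ℚᵘ
import Data.Rational.Unnormalised.Properties as ℚᵘ
open import Data.Fin using (Fin; zero; suc; toℕ)
open import Data.Fin.Properties using (toℕ-fromℕ<; toℕ-injective; toℕ<n) renaming (_≟_ to _≟F_)
open import Data.Vec using (Vec; []; _∷_)
open import Data.Bool using (Bool; true; false)
open import Data.Product using (Σ; _×_; _,_; proj₁; proj₂)
open import Data.Sum using (_⊎_; inj₁; inj₂)
open import Data.Empty using (⊥-elim)
open import Relation.Nullary using (yes; no)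
open import Relation.Nullary.Negation using (¬_)
open import Relation.Binary.PropositionalEquality
open import Relation.Binary.Definitions using (tri<; tri≈; tri>)

-- Sums and occurrence indicators

∑ : (ℕ → ℕ) → ℕ → ℕ
∑ f zero    = 0
∑ f (suc n) = ∑ f n + f n

∑-cong : ∀ {f g} n → (∀ {i} → i < n → f i ≡ g i) → ∑ f n ≡ ∑ g n
∑-cong zero    eq = refl
∑-cong (suc n) eq = cong₂ _+_ (∑-cong n (λ i<n → eq (m<n⇒m<1+n i<n))) (eq ≤-refl)

∑-const : ∀ c n → ∑ (λ _ → c) n ≡ n * c
∑-const c zero    = refl
∑-const c (suc n) = trans (cong (_+ c) (∑-const c n)) (+-comm (n * c) c)

∑-+ : ∀ f m n → ∑ f (m + n) ≡ ∑ f m + ∑ (λ i → f (m + i)) n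
∑-+ f m zero    = trans (cong (∑ f) (+-identityʳ m)) (sym (+-identityʳ _))
∑-+ f m (suc n) = begin
  ∑ f (m + suc n)                                 ≡⟨ cong (∑ f) (+-suc m n) ⟩
  ∑ f (m + n) + f (m + n)                         ≡⟨ cong (_+ f (m + n)) (∑-+ f m n) ⟩
  ∑ f m + ∑ (λ i → f (m + i)) n + f (m + n)       ≡⟨ +-assoc (∑ f m) _ _ ⟩
  ∑ f m + (∑ (λ i → f (m + i)) n + f (m + n))     ∎
  where open ≡-Reasoning

∑-distrib-+ : ∀ f g n → ∑ (λ i → f i + g i) n ≡ ∑ f n + ∑ g n
∑-distrib-+ f g zero    = refl
∑-distrib-+ f g (suc n) = trans (cong (_+ (f n + g n)) (∑-distrib-+ f g n)) (rearrange (∑ f n) (∑ g n) (f n) (g n))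
  where
  rearrange : ∀ a b c d → a + b + (c + d) ≡ a + c + (b + d)
  rearrange = solve-∀

∑-*ʳ : ∀ f c n → ∑ f n * c ≡ ∑ (λ i → f i * c) n
∑-*ʳ f c zero    = refl
∑-*ʳ f c (suc n) = trans (*-distribʳ-+ c (∑ f n) (f n)) (cong (_+ f n * c) (∑-*ʳ f c n))

∑-*ˡ : ∀ c f n → c * ∑ f n ≡ ∑ (λ i → c * f i) n
∑-*ˡ c f zero    = *-zeroʳ c
∑-*ˡ c f (suc n) = trans (*-distribˡ-+ c (∑ f n) (f n)) (cong (_+ c * f n) (∑-*ˡ c f n))

∑-swap : ∀ (f : ℕ → ℕ → ℕ) m n → ∑ (λ i → ∑ (f i) n) m ≡ ∑ (λ j → ∑ (λ i → f i j) m) n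
∑-swap f zero    n = sym (trans (∑-const 0 n) (*-zeroʳ n))
∑-swap f (suc m) n = trans (cong (_+ ∑ (f m) n) (∑-swap f m n)) (sym (∑-distrib-+ _ _ n))

∑-≤ : ∀ {f c} n → (∀ i → f i ≤ c) → ∑ f n ≤ n * c
∑-≤         zero    f≤c = z≤n
∑-≤ {f} {c} (suc n) f≤c = subst (_≤ c + n * c) (+-comm (f n) (∑ f n)) (+-mono-≤ (f≤c n) (∑-≤ n f≤c))

∑-* : ∀ f m n → ∑ f (m * n) ≡ ∑ (λ q → ∑ (λ i → f (q * n + i)) n) m
∑-* f zero    n = refl
∑-* f (suc m) n = begin
  ∑ f (n + m * n)                                   ≡⟨ cong (∑ f) (+-comm n (m * n)) ⟩
  ∑ f (m * n + n)                                   ≡⟨ ∑-+ f (m * n) n ⟩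
  ∑ f (m * n) + ∑ (λ i → f (m * n + i)) n           ≡⟨ cong (_+ ∑ (λ i → f (m * n + i)) n) (∑-* f m n) ⟩
  ∑ (λ q → ∑ (λ i → f (q * n + i)) n) (suc m)       ∎
  where open ≡-Reasoning

toℕᵇ : Bool → ℕ
toℕᵇ true  = 1
toℕᵇ false = 0

toℕᵇ≤1 : ∀ x → toℕᵇ x ≤ 1
toℕᵇ≤1 true  = ≤-refl
toℕᵇ≤1 false = z≤n

hit : ∀ {b w} → Digits b → Vec (Fin b) w → ℕ → ℕ
hit c ds i = toℕᵇ (occursAt c ds i)

count≡∑ : ∀ {b w} (c : Digits b) (ds : Vec (Fin b) w) n → count c ds n ≡ ∑ (hit c ds) n
count≡∑ c ds zero    = refl
count≡∑ c ds (suc n) with occursAt c ds n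
... | true  = trans (cong suc (count≡∑ c ds n)) (+-comm 1 _)
... | false = trans (count≡∑ c ds n) (sym (+-identityʳ _))

δ : ∀ {b} → Fin b → Fin b → ℕ
δ x d with x ≟F d
... | yes _ = 1
... | no  _ = 0

hit-∷ : ∀ {b w} (c : Digits b) d (ds : Vec (Fin b) w) i →
  hit c (d ∷ ds) i ≡ δ (c i) d * hit (λ j → c (suc j)) ds i
hit-∷ c d ds i with c i ≟F d
... | yes _ = sym (+-identityʳ _)
... | no  _ = refl

-- The index is written `t + i` because `suc` then passes between position and shifted sequence by
-- computation alone.
hit-cong : ∀ {b w} (c c′ : Digits b) (ds : Vec (Fin b) w) i i′ →
  (∀ {t} → t < w → c (t + i) ≡ c′ (t + i′)) → hit c ds i ≡ hit c′ ds i′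
hit-cong c c′ []       i i′ eq = refl
hit-cong c c′ (d ∷ ds) i i′ eq = begin
  hit c (d ∷ ds) i                              ≡⟨ hit-∷ c d ds i ⟩
  δ (c i) d * hit (λ j → c (suc j)) ds i        ≡⟨ cong₂ _*_ (cong (λ x → δ x d) (eq z<s))
                                                     (hit-cong _ _ ds i i′ (λ t<w → eq (s<s t<w))) ⟩
  δ (c′ i′) d * hit (λ j → c′ (suc j)) ds i′    ≡⟨ hit-∷ c′ d ds i′ ⟨
  hit c′ (d ∷ ds) i′                            ∎
  where open ≡-Reasoning

-- Division with remainder and residues as digits

[m+kn]/n≡k : ∀ {m} k {n} .{{_ : NonZero n}} → m < n → (k * n + m) / n ≡ k
[m+kn]/n≡k {m} k {n} m<n = begin
  (k * n + m) / n     ≡⟨ cong (_/ n) (+-comm (k * n) m) ⟩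
  (m + k * n) / n     ≡⟨ +-distrib-/-∣ʳ m (n∣m*n k) ⟩
  m / n + k * n / n   ≡⟨ cong₂ _+_ (m<n⇒m/n≡0 m<n) (m*n/n≡m k n) ⟩
  k                   ∎
  where open ≡-Reasoning

[kn+m]%n≡m : ∀ {m} k {n} .{{_ : NonZero n}} → m < n → (k * n + m) % n ≡ m
[kn+m]%n≡m {m} k {n} m<n = begin
  (k * n + m) % n ≡⟨ cong (_% n) (+-comm (k * n) m) ⟩
  (m + k * n) % n ≡⟨ [m+kn]%n≡m%n m k n ⟩
  m % n           ≡⟨ m<n⇒m%n≡m m<n ⟩
  m               ∎
  where open ≡-Reasoning

mod-block : ∀ {b} .{{_ : NonZero b}} q {e} (e<b : e < b) → toℕ ((q * b + e) mod b) ≡ e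
mod-block {b} q {e} e<b = trans (toℕ-fromℕ< (m%n<n (q * b + e) b)) ([kn+m]%n≡m q e<b)

-- Confining the hypothesis to `e < b` lets `x e` be `(Q * b + e) mod b`, which takes each digit
-- once over that range.
∑-δ-toℕ : ∀ {b} (d : Fin b) (x : ℕ → Fin b) → (∀ {e} → e < b → toℕ (x e) ≡ e) →
  ∑ (λ e → δ (x e) d) b ≡ 1
∑-δ-toℕ {b} d x eq = go b ≤-refl (toℕ<n d)
  where
  hits : ∀ {e} → e ≡ toℕ d → e < b → δ (x e) d ≡ 1
  hits {e} e≡d e<b with x e ≟F d
  ... | yes _ = refl
  ... | no ne = ⊥-elim (ne (toℕ-injective (trans (eq e<b) e≡d)))
  misses : ∀ {e} → e ≢ toℕ d → e < b → δ (x e) d ≡ 0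
  misses {e} e≢d e<b with x e ≟F d
  ... | yes p = ⊥-elim (e≢d (trans (sym (eq e<b)) (cong toℕ p)))
  ... | no _ = refl
  none : ∀ n → n ≤ toℕ d → n ≤ b → ∑ (λ e → δ (x e) d) n ≡ 0
  none n n≤d n≤b = trans (∑-cong n (λ i<n → misses (<⇒≢ (<-≤-trans i<n n≤d)) (<-≤-trans i<n n≤b)))
                         (trans (∑-const 0 n) (*-zeroʳ n))
  go : ∀ n → n ≤ b → toℕ d < n → ∑ (λ e → δ (x e) d) n ≡ 1
  go (suc n) n<b d<1+n with n ≟ toℕ d
  ... | yes n≡d = cong₂ _+_ (none n (≤-reflexive n≡d) (<⇒≤ n<b)) (hits n≡d n<b)
  ... | no  n≢d = cong₂ _+_ (go n (<⇒≤ n<b) (≤∧≢⇒< (≤-pred d<1+n) (λ d≡n → n≢d (sym d≡n)))) (misses n≢d n<b)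

-- Equidistribution of the base-b digits of consecutive integers

module _ {b : ℕ} .{{_ : NonZero b}} where

  digit : ℕ → ℕ → Fin b
  digit zero    Q = Q mod b
  digit (suc r) Q = digit r (Q / b)

  StrictlyIncreasing : (ℕ → ℕ) → Set
  StrictlyIncreasing ρ = ∀ t → ρ t < ρ (suc t)

  ρ-positive : ∀ {ρ} → StrictlyIncreasing ρ → 0 < ρ 0 → ∀ t → 0 < ρ t
  ρ-positive inc pos zero    = pos
  ρ-positive inc pos (suc t) = ≤-<-trans z≤n (inc t)

  -- Summing over the lowest digit of Q first: it is either constrained (one choice) or free (b choices).
  digits-equidistributed : ∀ {w} (ds : Vec (Fin b) w) ρ → StrictlyIncreasing ρ →
    ∀ R m → (∀ {t} → t < w → ρ t < R) →
    ∑ (λ q → hit (λ t → digit (ρ t) (m * b ^ R + q)) ds 0) (b ^ R) * b ^ w ≡ b ^ R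
  digits-equidistributed [] ρ inc R m bound =
    trans (*-identityʳ _) (trans (∑-const 1 (b ^ R)) (*-identityʳ _))
  digits-equidistributed (d ∷ ds) ρ inc zero    m bound = ⊥-elim (n≮0 (bound z<s))
  digits-equidistributed {suc w} (d ∷ ds) ρ inc (suc R) m bound = body (ρ 0) refl
    where
    open ≡-Reasoning
    F : ℕ → ℕ
    F Q = hit (λ t → digit (ρ t) Q) (d ∷ ds) 0

    by-lowest-digit : ∑ (λ q → F (m * b ^ suc R + q)) (b ^ suc R)
      ≡ ∑ (λ q → ∑ (λ e → F ((m * b ^ R + q) * b + e)) b) (b ^ R)
    by-lowest-digit = begin
      ∑ (λ q → F (m * b ^ suc R + q)) (b * b ^ R) ≡⟨ cong (∑ _) (*-comm b (b ^ R)) ⟩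
      ∑ (λ q → F (m * b ^ suc R + q)) (b ^ R * b) ≡⟨ ∑-* _ (b ^ R) b ⟩
      ∑ (λ q → ∑ (λ e → F (m * b ^ suc R + (q * b + e))) b) (b ^ R)
        ≡⟨ ∑-cong (b ^ R) (λ {q} _ → ∑-cong b (λ {e} _ → cong F (regroup m b (b ^ R) q e))) ⟩
      ∑ (λ q → ∑ (λ e → F ((m * b ^ R + q) * b + e)) b) (b ^ R) ∎
      where
      regroup : ∀ m b p q e → m * (b * p) + (q * b + e) ≡ (m * p + q) * b + e
      regroup = solve-∀

    shift : ∀ {r} Q {e} → e < b → 0 < r → digit r (Q * b + e) ≡ digit (pred r) Q
    shift {suc r} Q e<b _ = cong (digit r) ([m+kn]/n≡k Q e<b)

    -- The value of `ρ 0` is named `r` so that it can be matched on. If it is 0, `d` fixes the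
    -- lowest digit, and the later places, positive by monotonicity, drop by one. Otherwise no place
    -- is 0: the lowest digit is free and gives the factor `b`, and all places drop by one.
    body : ∀ r → ρ 0 ≡ r → ∑ (λ q → F (m * b ^ suc R + q)) (b ^ suc R) * b ^ suc w ≡ b ^ suc R
    body zero ρ0≡0 = begin
      ∑ (λ q → F (m * b ^ suc R + q)) (b ^ suc R) * (b * b ^ w)
        ≡⟨ cong (_* (b * b ^ w)) (trans by-lowest-digit (∑-cong (b ^ R) (λ {q} _ → inner (m * b ^ R + q)))) ⟩
      S * (b * b ^ w) ≡⟨ swap S b (b ^ w) ⟩
      b * (S * b ^ w) ≡⟨ cong (b *_) (digits-equidistributed ds ρ′ inc′ R m (λ t<w → pred-mono-< {{>-nonZero (tail-pos _)}} (bound (s<s t<w)))) ⟩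
      b * b ^ R       ∎
      where
      swap : ∀ s b p → s * (b * p) ≡ b * (s * p)
      swap = solve-∀
      tail-pos : ∀ t → 0 < ρ (suc t)
      tail-pos t = ≤-<-trans z≤n (inc t)
      ρ′ : ℕ → ℕ
      ρ′ t = pred (ρ (suc t))
      inc′ : StrictlyIncreasing ρ′
      inc′ t = pred-mono-< {{>-nonZero (tail-pos t)}} (inc (suc t))
      S = ∑ (λ q → hit (λ t → digit (ρ′ t) (m * b ^ R + q)) ds 0) (b ^ R)
      inner : ∀ Q → ∑ (λ e → F (Q * b + e)) b ≡ hit (λ t → digit (ρ′ t) Q) ds 0
      inner Q = begin
        ∑ (λ e → F (Q * b + e)) b
          ≡⟨ ∑-cong b (λ {e} e<b → trans (hit-∷ (λ t → digit (ρ t) (Q * b + e)) d ds 0) (cong₂ _*_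
               (cong (λ r → δ (digit r (Q * b + e)) d) ρ0≡0)
               (hit-cong (λ t → digit (ρ (suc t)) (Q * b + e)) (λ t → digit (ρ′ t) Q) ds 0 0 (λ {t} _ →
                 shift {ρ (suc (t + 0))} Q e<b (tail-pos (t + 0)))))) ⟩
        ∑ (λ e → δ ((Q * b + e) mod b) d * H) b ≡⟨ ∑-*ʳ _ H b ⟨
        ∑ (λ e → δ ((Q * b + e) mod b) d) b * H ≡⟨ cong (_* H) (∑-δ-toℕ d (λ e → (Q * b + e) mod b) (mod-block Q)) ⟩
        1 * H                                   ≡⟨ *-identityˡ H ⟩
        H                                       ∎
        where H = hit (λ t → digit (ρ′ t) Q) ds 0
    body (suc r) ρ0≡ = begin
      ∑ (λ q → F (m * b ^ suc R + q)) (b ^ suc R) * b ^ suc w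
        ≡⟨ cong (_* b ^ suc w) (trans by-lowest-digit (∑-cong (b ^ R) (λ {q} _ → inner (m * b ^ R + q)))) ⟩
      ∑ (λ q → b * G (m * b ^ R + q)) (b ^ R) * b ^ suc w ≡⟨ cong (_* b ^ suc w) (∑-*ˡ b _ (b ^ R)) ⟨
      b * ∑ (λ q → G (m * b ^ R + q)) (b ^ R) * b ^ suc w ≡⟨ *-assoc b _ _ ⟩
      b * (∑ (λ q → G (m * b ^ R + q)) (b ^ R) * b ^ suc w)
        ≡⟨ cong (b *_) (digits-equidistributed (d ∷ ds) ρ′ inc′ R m (λ t<w → pred-mono-< {{>-nonZero (all-pos _)}} (bound t<w))) ⟩
      b * b ^ R ∎
      where
      all-pos : ∀ t → 0 < ρ t
      all-pos = ρ-positive inc (subst (0 <_) (sym ρ0≡) z<s)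
      ρ′ : ℕ → ℕ
      ρ′ t = pred (ρ t)
      inc′ : StrictlyIncreasing ρ′
      inc′ t = pred-mono-< {{>-nonZero (all-pos t)}} (inc t)
      G : ℕ → ℕ
      G Q = hit (λ t → digit (ρ′ t) Q) (d ∷ ds) 0
      inner : ∀ Q → ∑ (λ e → F (Q * b + e)) b ≡ b * G Q
      inner Q = trans
        (∑-cong b (λ {e} e<b → hit-cong (λ t → digit (ρ t) (Q * b + e)) (λ t → digit (ρ′ t) Q) (d ∷ ds) 0 0 (λ {t} _ → shift {ρ (t + 0)} Q e<b (all-pos (t + 0)))))
        (∑-const (G Q) b)

  -- The sequence x and its doubling

  -- The length of one run in `x`: there are `b ^ (s !)` words, each of `s !` digits.
  period : ℕ → ℕ
  period s = b ^ (s !) * s !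

  onset : ℕ → ℕ
  onset s = s * period s

  -- Makes `onset (suc s)` a multiple of `period s`, so that each stage consists of whole runs.
  period∣period : ∀ s → period s ∣ period (suc s)
  period∣period s = *-pres-∣ (^-monoʳ-∣ s!≤[1+s]!) (n∣m*n (suc s))
    where
    s!≤[1+s]! : s ! ≤ suc s !
    s!≤[1+s]! = m≤n*m (s !) (suc s)
    ^-monoʳ-∣ : ∀ {m n} → m ≤ n → b ^ m ∣ b ^ n
    ^-monoʳ-∣ {m} {n} m≤n = subst (b ^ m ∣_)
      (trans (sym (^-distribˡ-+-* b m (n ∸ m))) (cong (b ^_) (m+[n∸m]≡n m≤n)))
      (m∣m*n (b ^ (n ∸ m)))

  period≢0 : ∀ s → NonZero (period s)
  period≢0 s = m*n≢0 (b ^ (s !)) (s !) {{m^n≢0 b (s !)}} {{s !≢0}}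

  period-≤ : ∀ s → period s ≤ period (suc s)
  period-≤ s = ∣⇒≤ {{period≢0 (suc s)}} (period∣period s)

  onset-< : ∀ s → onset s < onset (suc s)
  onset-< s = ≤-<-trans (*-monoʳ-≤ s (period-≤ s))
    (m<n+m (s * period (suc s)) (>-nonZero⁻¹ (period (suc s)) {{period≢0 (suc s)}}))

  onset-mono : ∀ {s s′} → s ≤ s′ → onset s ≤ onset s′
  onset-mono {s} {zero}   z≤n = ≤-refl
  onset-mono {s} {suc s′} s≤1+s′ with m≤n⇒m<n∨m≡n s≤1+s′
  ... | inj₁ (s≤s s≤s′) = ≤-trans (onset-mono s≤s′) (<⇒≤ (onset-< s′))
  ... | inj₂ refl       = ≤-refl

  -- Tracks the `s` with `onset s ≤ t < onset (suc s)`. One increment per step is enough because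
  -- `onset` is strictly increasing.
  stage : ℕ → ℕ
  stage zero    = 0
  stage (suc t) with onset (suc (stage t)) ≤? suc t
  ... | yes _ = suc (stage t)
  ... | no  _ = stage t

  onset≤ : ∀ t → onset (stage t) ≤ t
  onset≤ zero    = z≤n
  onset≤ (suc t) with onset (suc (stage t)) ≤? suc t
  ... | yes p = p
  ... | no  _ = m≤n⇒m≤1+n (onset≤ t)

  <onset : ∀ t → t < onset (suc (stage t))
  <onset zero    = onset-< 0
  <onset (suc t) with onset (suc (stage t)) ≤? suc t
  ... | yes _ = ≤-<-trans (<onset t) (onset-< (suc (stage t)))
  ... | no ¬p = ≰⇒> ¬p

  stage-unique : ∀ s t → onset s ≤ t → t < onset (suc s) → stage t ≡ s
  stage-unique s t lo hi with <-cmp (stage t) s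
  ... | tri< lt _ _ = ⊥-elim (<⇒≱ (<onset t) (≤-trans (onset-mono lt) lo))
  ... | tri≈ _ eq _ = eq
  ... | tri> _ _ gt = ⊥-elim (<⇒≱ hi (≤-trans (onset-mono gt) (onset≤ t)))

  -- The word number is not reduced modulo `b ^ (s !)`: only its lowest `s !` digits are ever read,
  -- so plain counting is already cyclic.
  periodicDigit : ℕ → ℕ → Fin b
  periodicDigit s t = digit (_%_ t (s !) {{s !≢0}}) (_/_ t (s !) {{s !≢0}})

  -- In stage s, the words of length s! are the numbers in base b, lowest digit first, counted cyclically.
  x : Digits b
  x t = periodicDigit (stage t) t

  x-in-word : ∀ s Q {r} → r < s ! → onset s ≤ Q * s ! + r → Q * s ! + r < onset (suc s) →
    x (Q * s ! + r) ≡ digit r Q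
  x-in-word s Q {r} r<s! lo hi = begin
    periodicDigit (stage t) t ≡⟨ cong (λ σ → periodicDigit σ t) (stage-unique s t lo hi) ⟩
    periodicDigit s t         ≡⟨ cong₂ digit ([kn+m]%n≡m Q {{s !≢0}} r<s!) ([m+kn]/n≡k Q {{s !≢0}} r<s!) ⟩
    digit r Q                 ∎
    where
    open ≡-Reasoning
    t = Q * s ! + r

  doubled : Digits b
  doubled n = x ⌊ n /2⌋

-- Discrepancy along an arithmetic progression

⌊n*2+r/2⌋≡n+⌊r/2⌋ : ∀ n r → ⌊ n * 2 + r /2⌋ ≡ n + ⌊ r /2⌋
⌊n*2+r/2⌋≡n+⌊r/2⌋ zero    r = refl
⌊n*2+r/2⌋≡n+⌊r/2⌋ (suc n) r = cong suc (⌊n*2+r/2⌋≡n+⌊r/2⌋ n r)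

r<n*2⇒⌊r/2⌋<n : ∀ {r} n → r < n * 2 → ⌊ r /2⌋ < n
r<n*2⇒⌊r/2⌋<n {zero}        (suc n) _                 = z<s
r<n*2⇒⌊r/2⌋<n {suc zero}    (suc n) _                 = z<s
r<n*2⇒⌊r/2⌋<n {suc (suc r)} (suc n) (s≤s (s≤s r<n*2)) = s<s (r<n*2⇒⌊r/2⌋<n n r<n*2)

∣-∣-+ : ∀ m n o p → ∣ m + n - o + p ∣ ≤ ∣ m - o ∣ + ∣ n - p ∣
∣-∣-+ m n o p = begin
  ∣ m + n - o + p ∣                         ≤⟨ ∣-∣-triangle (m + n) (o + n) (o + p) ⟩
  ∣ m + n - o + n ∣ + ∣ o + n - o + p ∣     ≡⟨ cong₂ _+_ left (∣m+n-m+o∣≡∣n-o∣ o n p) ⟩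
  ∣ m - o ∣ + ∣ n - p ∣                     ∎
  where
  open ≤-Reasoning
  left : ∣ m + n - o + n ∣ ≡ ∣ m - o ∣
  left = trans (cong₂ ∣_-_∣ (+-comm m n) (+-comm o n)) (∣m+n-m+o∣≡∣n-o∣ n m o)

-- The crude bound, for stretches about whose hits nothing is known: `m * B` and `n` both lie
-- between 0 and `n * B`.
∣m*B-n∣≤n*B : ∀ {m n} B .{{_ : NonZero B}} → m ≤ n → ∣ m * B - n ∣ ≤ n * B
∣m*B-n∣≤n*B {m} {n} B m≤n =
  ≤-trans (∣m-n∣≤m⊔n (m * B) n) (⊔-lub (*-monoˡ-≤ B m≤n) (m≤m*n n B))

-- The first `g` terms cancel exactly, and the other `h` are charged the crude bound.
∑-mostly : ∀ {f c} B .{{_ : NonZero B}} g h → (∀ i → f i ≤ c) → (∀ {i} → i < g → f i * B ≡ c) →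
  ∣ ∑ f (g + h) * B - (g + h) * c ∣ ≤ h * c * B
∑-mostly {f} {c} B g h f≤c exact = begin
  ∣ ∑ f (g + h) * B - (g + h) * c ∣ ≡⟨ cong₂ ∣_-_∣ (trans (cong (_* B) (∑-+ f g h)) (*-distribʳ-+ B (∑ f g) Y)) (*-distribʳ-+ c g h) ⟩
  ∣ ∑ f g * B + Y * B - g * c + h * c ∣ ≡⟨ cong (λ z → ∣ z + Y * B - g * c + h * c ∣) head ⟩
  ∣ g * c + Y * B - g * c + h * c ∣ ≡⟨ ∣m+n-m+o∣≡∣n-o∣ (g * c) _ _ ⟩
  ∣ Y * B - h * c ∣ ≤⟨ ∣m*B-n∣≤n*B B (∑-≤ h (λ i → f≤c (g + i))) ⟩
  h * c * B ∎
  where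
  open ≤-Reasoning
  Y = ∑ (λ i → f (g + i)) h
  head : ∑ f g * B ≡ g * c
  head = trans (∑-*ʳ f B g) (trans (∑-cong g exact) (∑-const c g))

n≤n! : ∀ n → n ≤ n !
n≤n! zero    = z≤n
n≤n! (suc n) = m≤m*n (suc n) (n !) {{n !≢0}}

n∣n! : ∀ n .{{_ : NonZero n}} → n ∣ n !
n∣n! (suc n) = m∣m*n (n !)

module _ {b : ℕ} .{{_ : NonZero b}} (k ℓ : ℕ) (2≤ℓ : 2 ≤ ℓ) {w : ℕ} (ds : Vec (Fin b) w) where

  private
    B h : ℕ
    B = b ^ w
    -- Bounding the start `k` by `k * ℓ` turns it into `k` extra terms. Together with the window
    -- length this gives the number of offsets at the end of a word that are given up.
    h = k + w

    instance
      B≢0 : NonZero B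
      B≢0 = m^n≢0 b w
      ℓ≢0 : NonZero ℓ
      ℓ≢0 = >-nonZero (<-≤-trans z<s 2≤ℓ)

  sampled : Digits b
  sampled j = doubled (k + j * ℓ)

  -- The distance of the frequency from `1 / B`, multiplied by `n * B` to stay within ℕ.
  discrepancy : ℕ → ℕ
  discrepancy n = ∣ ∑ (hit sampled ds) n * B - n ∣

  -- `V` is the number of terms of the progression per doubled word, and `m` numbers a run; `s≤m`
  -- and `end` say that this run lies within stage `s`.
  module _ (s m V : ℕ) (Vℓ≡ : V * ℓ ≡ s ! * 2) (s≤m : s ≤ m) (end : suc m * period {b} s ≤ onset {b} (suc s)) where

    private
      p : ℕ
      p = b ^ (s !)

    window-in-word : ∀ i {t} → i + h ≤ V → t < w → ⌊ k + (i + t) * ℓ /2⌋ < s !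
    window-in-word i {t} i+h≤V t<w = r<n*2⇒⌊r/2⌋<n (s !) (begin-strict
      k + (i + t) * ℓ       ≤⟨ +-monoˡ-≤ _ (m≤m*n k ℓ) ⟩
      k * ℓ + (i + t) * ℓ   ≡⟨ *-distribʳ-+ ℓ k (i + t) ⟨
      (k + (i + t)) * ℓ     <⟨ *-monoˡ-< ℓ (+-monoʳ-< k (+-monoʳ-< i t<w)) ⟩
      (k + (i + w)) * ℓ     ≡⟨ cong (_* ℓ) (regroup k i w) ⟩
      (i + h) * ℓ           ≤⟨ *-monoˡ-≤ ℓ i+h≤V ⟩
      V * ℓ                 ≡⟨ Vℓ≡ ⟩
      s ! * 2               ∎)
      where
      open ≤-Reasoning
      regroup : ∀ k i w → k + (i + w) ≡ i + (k + w)
      regroup = solve-∀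

    -- By `Vℓ≡`, advancing `V` terms moves exactly one word ahead in `x`, so the place read inside
    -- the word depends on `i + t` and not on the word.
    sampled-digit : ∀ {q i t} → q < p → i + h ≤ V → t < w →
      sampled (t + ((m * p + q) * V + i)) ≡ digit ⌊ k + (i + t) * ℓ /2⌋ (m * p + q)
    sampled-digit {q} {i} {t} q<p i+h≤V t<w = trans (cong x halved) (x-in-word s Q r<s! lo hi)
      where
      Q = m * p + q
      r = ⌊ k + (i + t) * ℓ /2⌋
      halved : ⌊ k + (t + (Q * V + i)) * ℓ /2⌋ ≡ Q * s ! + r
      halved = begin
        ⌊ k + (t + (Q * V + i)) * ℓ /2⌋           ≡⟨ cong ⌊_/2⌋ (regroup k t Q V i ℓ) ⟩
        ⌊ Q * (V * ℓ) + (k + (i + t) * ℓ) /2⌋     ≡⟨ cong (λ z → ⌊ Q * z + (k + (i + t) * ℓ) /2⌋) Vℓ≡ ⟩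
        ⌊ Q * (s ! * 2) + (k + (i + t) * ℓ) /2⌋   ≡⟨ cong (λ z → ⌊ z + (k + (i + t) * ℓ) /2⌋) (*-assoc Q (s !) 2) ⟨
        ⌊ Q * s ! * 2 + (k + (i + t) * ℓ) /2⌋     ≡⟨ ⌊n*2+r/2⌋≡n+⌊r/2⌋ (Q * s !) _ ⟩
        Q * s ! + r                               ∎
        where
        open ≡-Reasoning
        regroup : ∀ k t Q V i ℓ → k + (t + (Q * V + i)) * ℓ ≡ Q * (V * ℓ) + (k + (i + t) * ℓ)
        regroup = solve-∀
      open ≤-Reasoning
      r<s! : r < s !
      r<s! = window-in-word i i+h≤V t<w
      lo : onset s ≤ Q * s ! + r
      lo = begin
        s * (p * s !)     ≤⟨ *-monoˡ-≤ (p * s !) s≤m ⟩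
        m * (p * s !)     ≡⟨ *-assoc m p (s !) ⟨
        m * p * s !       ≤⟨ *-monoˡ-≤ (s !) (m≤m+n (m * p) q) ⟩
        Q * s !           ≤⟨ m≤m+n (Q * s !) r ⟩
        Q * s ! + r       ∎
      hi : Q * s ! + r < onset (suc s)
      hi = begin-strict
        Q * s ! + r           <⟨ +-monoʳ-< (Q * s !) r<s! ⟩
        Q * s ! + s !         ≡⟨ +-comm (Q * s !) (s !) ⟩
        suc Q * s !           ≡⟨ cong (_* s !) (+-suc (m * p) q) ⟨
        (m * p + suc q) * s ! ≤⟨ *-monoˡ-≤ (s !) (+-monoʳ-≤ (m * p) q<p) ⟩
        (m * p + p) * s !     ≡⟨ cong (_* s !) (+-comm (m * p) p) ⟩
        suc m * p * s !       ≡⟨ *-assoc (suc m) p (s !) ⟩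
        suc m * (p * s !)     ≤⟨ end ⟩
        onset (suc s)         ∎

    -- For a fixed offset i in the word, all p words are seen once; only the last h offsets
    -- give windows that may leave their word.
    block-discrepancy : h ≤ V →
      ∣ ∑ (λ i → hit sampled ds (m * (p * V) + i)) (p * V) * B - p * V ∣ ≤ p * (h * B)
    block-discrepancy h≤V = begin
      ∣ ∑ (λ i → hit sampled ds (m * (p * V) + i)) (p * V) * B - p * V ∣ ≡⟨ cong₂ ∣_-_∣ (cong (_* B) by-offset) (trans (*-comm p V) (cong (_* p) (sym g+h≡V))) ⟩
      ∣ ∑ f (g + h) * B - (g + h) * p ∣ ≤⟨ ∑-mostly B g h f≤p exact ⟩
      h * p * B ≡⟨ regroup h p B ⟩
      p * (h * B) ∎
      where
      open ≤-Reasoning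
      g = V ∸ h
      g+h≡V : g + h ≡ V
      g+h≡V = m∸n+n≡m h≤V
      regroup : ∀ h p B → h * p * B ≡ p * (h * B)
      regroup = solve-∀
      f : ℕ → ℕ
      f i = ∑ (λ q → hit sampled ds ((m * p + q) * V + i)) p
      f≤p : ∀ i → f i ≤ p
      f≤p i = subst (f i ≤_) (*-identityʳ p) (∑-≤ p (λ q → toℕᵇ≤1 (occursAt sampled ds _)))
      by-offset : ∑ (λ i → hit sampled ds (m * (p * V) + i)) (p * V) ≡ ∑ f (g + h)
      by-offset = trans (∑-* _ p V) (trans
        (∑-cong p (λ {q} _ → ∑-cong V (λ {i} _ → cong (hit sampled ds) (assoc m p V q i))))
        (trans (∑-swap _ p V) (cong (∑ f) (sym g+h≡V))))
        where
        assoc : ∀ m p V q i → m * (p * V) + (q * V + i) ≡ (m * p + q) * V + i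
        assoc = solve-∀
      exact : ∀ {i} → i < g → f i * B ≡ p
      exact {i} i<g = trans
        (cong (_* B) (∑-cong p (λ {q} q<p → hit-cong sampled (λ t → digit (ρ t) (m * p + q)) ds _ 0
          (λ {t} t<w → trans (sampled-digit {q} q<p i+h≤V t<w)
            (cong (λ t → digit (ρ t) (m * p + q)) (sym (+-identityʳ t)))))))
        (digits-equidistributed ds ρ inc (s !) m (window-in-word i i+h≤V))
        where
        ρ : ℕ → ℕ
        ρ t = ⌊ k + (i + t) * ℓ /2⌋
        i+h≤V : i + h ≤ V
        i+h≤V = subst (i + h ≤_) g+h≡V (+-monoˡ-≤ h (<⇒≤ i<g))
        -- Here `2 ≤ ℓ` enters: indices at least two apart have different halves.
        inc : ∀ t → ρ t < ρ (suc t)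
        inc t = ⌊n/2⌋-mono (begin
          2 + (k + (i + t) * ℓ) ≤⟨ +-monoˡ-≤ _ 2≤ℓ ⟩
          ℓ + (k + (i + t) * ℓ) ≡⟨ step ℓ k i t ⟩
          k + (i + suc t) * ℓ   ∎)
          where
          step : ∀ ℓ k i t → ℓ + (k + (i + t) * ℓ) ≡ k + (i + (1 + t)) * ℓ
          step = solve-∀

  -- Accumulation of the error over runs and stages

  module _ (M : ℕ) .{{_ : NonZero M}} where

    private
      C₀ s₀ : ℕ
      -- With at least `C₀` slots, the `h` bad offsets fit into a word and `M` times the error of a
      -- run is at most the number of its terms. The factor `ℓ` in `s₀` secures this together with
      -- `ℓ ≤ s`; the summand `M * B` makes an incomplete run negligible.
      C₀ = h + M * (h * B)
      s₀ = ℓ * suc C₀ + M * B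

    slots : ℕ → ℕ
    slots s = s ! * 2 / ℓ

    -- Terms of the progression per run of stage s (2·period s digits of the doubled sequence); exact once ℓ ≤ s.
    block : ℕ → ℕ
    block s = b ^ (s !) * slots s

    slots*ℓ : ∀ {s} → ℓ ≤ s → slots s * ℓ ≡ s ! * 2
    slots*ℓ ℓ≤s = m/n*n≡m (∣-trans (∣-trans (n∣n! ℓ) (m≤n⇒m!∣n! ℓ≤s)) (m∣m*n 2))

    block*ℓ : ∀ {s} → ℓ ≤ s → block s * ℓ ≡ period {b} s * 2
    block*ℓ {s} ℓ≤s = begin
      b ^ (s !) * slots s * ℓ     ≡⟨ *-assoc (b ^ (s !)) (slots s) ℓ ⟩
      b ^ (s !) * (slots s * ℓ)   ≡⟨ cong (b ^ (s !) *_) (slots*ℓ ℓ≤s) ⟩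
      b ^ (s !) * (s ! * 2)       ≡⟨ *-assoc (b ^ (s !)) (s !) 2 ⟨
      period {b} s * 2            ∎
      where open ≡-Reasoning

    0<block : ∀ {s} → ℓ ≤ s → 0 < block s
    0<block {s} ℓ≤s = *-cancelʳ-< ℓ 0 (block s) (subst (0 <_) (sym (block*ℓ ℓ≤s))
      (>-nonZero⁻¹ (period {b} s * 2) {{m*n≢0 (period {b} s) 2 {{period≢0 {b} s}}}}))

    s₀≤⇒ℓ≤ : ∀ {s} → s₀ ≤ s → ℓ ≤ s
    s₀≤⇒ℓ≤ = ≤-trans (≤-trans (m≤m*n ℓ (suc C₀)) (m≤m+n (ℓ * suc C₀) (M * B)))

    s₀≤⇒MB≤ : ∀ {s} → s₀ ≤ s → M * B ≤ s
    s₀≤⇒MB≤ = ≤-trans (m≤n+m (M * B) (ℓ * suc C₀))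

    s₀≤⇒C₀≤slots : ∀ {s} → s₀ ≤ s → C₀ ≤ slots s
    s₀≤⇒C₀≤slots {s} s₀≤s = *-cancelʳ-≤ C₀ (slots s) ℓ (begin
      C₀ * ℓ                    ≤⟨ *-monoˡ-≤ ℓ (n≤1+n C₀) ⟩
      suc C₀ * ℓ                ≡⟨ *-comm (suc C₀) ℓ ⟩
      ℓ * suc C₀                ≤⟨ m≤m+n (ℓ * suc C₀) (M * B) ⟩
      s₀                        ≤⟨ s₀≤s ⟩
      s                         ≤⟨ n≤n! s ⟩
      s !                       ≤⟨ m≤m*n (s !) 2 ⟩
      s ! * 2                   ≡⟨ slots*ℓ (s₀≤⇒ℓ≤ s₀≤s) ⟨
      slots s * ℓ               ∎)
      where open ≤-Reasoning

    private
      j₀ C : ℕ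
      -- The terms before stage `s₀` are not analysed; the constant `C` pays for their error.
      j₀ = s₀ * block s₀
      C = M * discrepancy j₀

    -- The invariant for the run containing term `n`. Runs are numbered as if the length `block s`
    -- had been in force from the start, whence `s ≤ m`. The error is recorded at the start of the
    -- run, where each completed run has added at most its own length.
    record BlockAt (n : ℕ) : Set where
      field
        s m   : ℕ
        s₀≤s  : s₀ ≤ s
        s≤m   : s ≤ m
        end   : suc m * period {b} s ≤ onset {b} (suc s)
        lower : m * block s ≤ n
        upper : n < suc m * block s
        error : M * discrepancy (m * block s) ≤ C + m * block s

    first-block : BlockAt j₀
    first-block = record
      { s = s₀ ; m = s₀ ; s₀≤s = ≤-refl ; s≤m = ≤-refl
      ; end = *-monoʳ-≤ (suc s₀) (period-≤ {b} s₀)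
      ; lower = ≤-refl
      ; upper = m<n+m j₀ (0<block (s₀≤⇒ℓ≤ ≤-refl))
      ; error = m≤m+n C j₀ }

    discrepancy-+ : ∀ j p → discrepancy (j + p) ≤
      discrepancy j + ∣ ∑ (λ i → hit sampled ds (j + i)) p * B - p ∣
    discrepancy-+ j p = ≤-trans
      (≤-reflexive (cong (λ z → ∣ z - j + p ∣)
        (trans (cong (_* B) (∑-+ (hit sampled ds) j p)) (*-distribʳ-+ B (∑ (hit sampled ds) j) _))))
      (∣-∣-+ (∑ (hit sampled ds) j * B) (∑ (λ i → hit sampled ds (j + i)) p * B) j p)

    next-block : ∀ {n} → BlockAt n → BlockAt (suc n)
    next-block {n} β with suc n <? suc (BlockAt.m β) * block (BlockAt.s β)
    ... | yes 1+n< = record { BlockAt β ; lower = m≤n⇒m≤1+n (BlockAt.lower β) ; upper = 1+n< }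
    ... | no  1+n≮ = advance (m≤n⇒m<n∨m≡n end)
      where
      open BlockAt β
      ℓ≤s = s₀≤⇒ℓ≤ s₀≤s
      P = block s
      p = b ^ (s !)

      1+n≡ : suc m * P ≡ suc n
      1+n≡ = ≤-antisym (≮⇒≥ 1+n≮) upper

      -- The new run adds at most `p * (h * B)`, and `M * (h * B) ≤ slots s` turns `M` times this
      -- into at most `P`.
      error′ : M * discrepancy (suc m * P) ≤ C + suc m * P
      error′ = begin
        M * discrepancy (P + m * P)       ≡⟨ cong (λ z → M * discrepancy z) (+-comm P (m * P)) ⟩
        M * discrepancy (m * P + P)       ≤⟨ *-monoʳ-≤ M (discrepancy-+ (m * P) P) ⟩
        M * (discrepancy (m * P) + ∣ ∑ (λ i → hit sampled ds (m * P + i)) P * B - P ∣)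
          ≤⟨ *-monoʳ-≤ M (+-monoʳ-≤ (discrepancy (m * P)) (block-discrepancy s m (slots s) (slots*ℓ ℓ≤s) s≤m end
               (≤-trans (m≤m+n h _) (s₀≤⇒C₀≤slots s₀≤s)))) ⟩
        M * (discrepancy (m * P) + p * (h * B)) ≡⟨ regroup M (discrepancy (m * P)) p (h * B) ⟩
        M * discrepancy (m * P) + p * (M * (h * B))
          ≤⟨ +-mono-≤ error (*-monoʳ-≤ p (≤-trans (m≤n+m _ h) (s₀≤⇒C₀≤slots s₀≤s))) ⟩
        C + m * P + P             ≡⟨ regroup′ C (m * P) P ⟩
        C + suc m * P             ∎
        where
        open ≤-Reasoning
        regroup : ∀ M e p x → M * (e + p * x) ≡ M * e + p * (M * x)
        regroup = solve-∀
        regroup′ : ∀ C x y → C + x + y ≡ C + (y + x)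
        regroup′ = solve-∀

      advance : suc m * period {b} s < onset {b} (suc s) ⊎ suc m * period {b} s ≡ onset {b} (suc s) → BlockAt (suc n)
      advance (inj₁ before) = record
        { s = s ; m = suc m ; s₀≤s = s₀≤s ; s≤m = m≤n⇒m≤1+n s≤m
        ; end = end′
        ; lower = ≤-reflexive 1+n≡
        ; upper = subst (_< suc (suc m) * P) 1+n≡ (m<n+m (suc m * P) (0<block ℓ≤s))
        ; error = error′ }
        where
        end′ : suc (suc m) * period {b} s ≤ onset {b} (suc s)
        -- The next onset is a multiple of `period s`, so if it is not reached yet, another whole
        -- run fits before it.
        end′ with ∣-trans (period∣period {b} s) (n∣m*n (suc s))
        ... | divides c eq = subst (suc (suc m) * period {b} s ≤_) (sym eq)
              (*-monoˡ-≤ (period {b} s) (*-cancelʳ-< (period {b} s) (suc m) c (subst (suc m * period {b} s <_) eq before)))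
      advance (inj₂ at-end) = record
        { s = suc s ; m = suc s ; s₀≤s = m≤n⇒m≤1+n s₀≤s ; s≤m = ≤-refl
        ; end = *-monoʳ-≤ (suc (suc s)) (period-≤ {b} (suc s))
        ; lower = ≤-reflexive (trans (sym same) 1+n≡)
        ; upper = subst (_< suc (suc s) * block (suc s)) (trans (sym same) 1+n≡)
                    (m<n+m (suc s * block (suc s)) (0<block ℓ≤1+s))
        ; error = subst (λ z → M * discrepancy z ≤ C + z) same error′ }
        where
        open ≡-Reasoning
        ℓ≤1+s = m≤n⇒m≤1+n ℓ≤s
        in-digits : ∀ m {s} → ℓ ≤ s → m * block s * ℓ ≡ m * period {b} s * 2
        in-digits m {s} ℓ≤s = begin
          m * block s * ℓ         ≡⟨ *-assoc m (block s) ℓ ⟩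
          m * (block s * ℓ)       ≡⟨ cong (m *_) (block*ℓ ℓ≤s) ⟩
          m * (period {b} s * 2)  ≡⟨ *-assoc m (period {b} s) 2 ⟨
          m * period {b} s * 2    ∎
        -- At a change of stage the old and the new numbering of runs name the same term.
        -- Multiplying by `ℓ` reduces this to an equality of digit counts.
        same : suc m * P ≡ suc s * block (suc s)
        same = *-cancelʳ-≡ (suc m * P) (suc s * block (suc s)) ℓ (begin
          suc m * P * ℓ                   ≡⟨ in-digits (suc m) ℓ≤s ⟩
          suc m * period {b} s * 2        ≡⟨ cong (_* 2) at-end ⟩
          suc s * period {b} (suc s) * 2  ≡⟨ in-digits (suc s) ℓ≤1+s ⟨
          suc s * block (suc s) * ℓ       ∎)

    block-at : ∀ d → BlockAt (d + j₀)
    block-at zero    = first-block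
    block-at (suc d) = next-block (block-at d)

    -- Three contributions of at most `n` each: the constant `C`, the completed runs, and the
    -- incomplete run, for which `M * B ≤ m` makes the crude bound at most `m * block s`.
    discrepancy-small : Σ ℕ (λ N → ∀ n → N ≤ n → M * discrepancy n ≤ 3 * n)
    discrepancy-small = C + j₀ , bound
      where
      bound : ∀ n → C + j₀ ≤ n → M * discrepancy n ≤ 3 * n
      bound n C+j₀≤n = begin
        M * discrepancy n                                   ≡⟨ cong (λ z → M * discrepancy z) (m+[n∸m]≡n lower) ⟨
        M * discrepancy (j + d)                             ≤⟨ *-monoʳ-≤ M (discrepancy-+ j d) ⟩
        M * (discrepancy j + ∣ Y * B - d ∣)                 ≤⟨ *-monoʳ-≤ M (+-monoʳ-≤ (discrepancy j) (∣m*B-n∣≤n*B B Y≤d)) ⟩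
        M * (discrepancy j + d * B)                         ≡⟨ regroup M (discrepancy j) d B ⟩
        M * discrepancy j + (M * B) * d                     ≤⟨ +-mono-≤ error (*-mono-≤ (≤-trans (s₀≤⇒MB≤ s₀≤s) s≤m) d≤P) ⟩
        C + j + j                                           ≤⟨ +-mono-≤ (+-mono-≤ (≤-trans (m≤m+n C j₀) C+j₀≤n) lower) lower ⟩
        n + n + n                                           ≡⟨ triple n ⟩
        3 * n                                               ∎
        where
        open ≤-Reasoning
        open BlockAt (subst BlockAt (m∸n+n≡m (≤-trans (m≤n+m j₀ C) C+j₀≤n)) (block-at (n ∸ j₀)))
        j = m * block s
        d = n ∸ j
        Y = ∑ (λ i → hit sampled ds (j + i)) d
        Y≤d : Y ≤ d
        Y≤d = subst (Y ≤_) (*-identityʳ d) (∑-≤ d (λ i → toℕᵇ≤1 (occursAt sampled ds (j + i))))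
        d≤P : d ≤ block s
        d≤P = ≤-trans (∸-monoˡ-≤ j (<⇒≤ upper)) (≤-reflexive (m+n∸n≡m (block s) j))
        regroup : ∀ M e d B → M * (e + d * B) ≡ M * e + M * B * d
        regroup = solve-∀
        triple : ∀ n → n + n + n ≡ 3 * n
        triple = solve-∀

-- Frequencies as rational numbers

∣m⊖n∣≡∣m-n∣ : ∀ m n → ℤ.∣ m ⊖ n ∣ ≡ ∣ m - n ∣
∣m⊖n∣≡∣m-n∣ m n with ≤-total m n
... | inj₁ m≤n = trans (ℤ.∣⊖∣-≤ m≤n) (sym (m≤n⇒∣m-n∣≡n∸m m≤n))
... | inj₂ n≤m = trans (cong ℤ.∣_∣ (ℤ.⊖-≥ n≤m)) (sym (m≤n⇒∣n-m∣≡n∸m n≤m))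

-- Passes to unnormalised rationals, where numerator and denominator of the difference are explicit.
toℚᵘ-distance : ∀ p q → toℚᵘ ℚ.∣ fromℚᵘ p ℚ.- fromℚᵘ q ∣ ℚᵘ.≃ ℚᵘ.∣ p ℚᵘ.- q ∣
toℚᵘ-distance p q = ℚᵘ.≃-trans (ℚ.toℚᵘ-homo-∣-∣ (fromℚᵘ p ℚ.- fromℚᵘ q)) (ℚᵘ.∣-∣-cong
  (ℚᵘ.≃-trans (ℚ.toℚᵘ-homo-+ (fromℚᵘ p) (ℚ.- fromℚᵘ q)) (ℚᵘ.+-cong (ℚ.toℚᵘ-fromℚᵘ p)
    (ℚᵘ.≃-trans (ℚ.toℚᵘ-homo‿- (fromℚᵘ q)) (ℚᵘ.-‿cong (ℚ.toℚᵘ-fromℚᵘ q))))))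

-- A positive `ε` is at least `1 / ↧ₙ ε`, so it suffices to compare with that, which is an
-- inequality in ℕ after clearing denominators.
distance-< : ∀ c n B .{{_ : NonZero B}} ε → 0ℚ <ℚ ε → ℚ.↧ₙ ε * ∣ c * B - suc n ∣ < suc n →
  ℚ.∣ (+ c) ℚ./ suc n ℚ.- (+ 1) ℚ./ B ∣ <ℚ ε
distance-< c n B@(suc B-1) ε@(mkℚ +[1+ a ] d-1 _) 0<ε close =
  ℚ.toℚᵘ-cancel-< (ℚᵘ.<-respˡ-≃ (ℚᵘ.≃-sym (toℚᵘ-distance (mkℚᵘ (+ c) n) (mkℚᵘ (+ 1) B-1))) (ℚᵘ.*<* (
    subst₂ ℤ._<_ (ℤ.pos-* ℤ.∣ + c ℤ.* + B ℤ.+ (ℤ.- (+ 1)) ℤ.* + suc n ∣ (suc d-1)) (ℤ.pos-* (suc a) (suc n * B)) (+<+ nat))))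
  where
  numerator : ℤ.∣ + c ℤ.* + B ℤ.+ (ℤ.- (+ 1)) ℤ.* + suc n ∣ ≡ ∣ c * B - suc n ∣
  numerator = trans (cong ℤ.∣_∣ (cong₂ ℤ._+_ (sym (ℤ.pos-* c B)) (ℤ.-1*i≡-i (+ suc n))))
    (trans (cong ℤ.∣_∣ (ℤ.m-n≡m⊖n (c * B) (suc n))) (∣m⊖n∣≡∣m-n∣ (c * B) (suc n)))
  open ≤-Reasoning
  nat : ℤ.∣ + c ℤ.* + B ℤ.+ (ℤ.- (+ 1)) ℤ.* + suc n ∣ * suc d-1 < suc a * (suc n * B)
  nat = begin-strict
    ℤ.∣ + c ℤ.* + B ℤ.+ (ℤ.- (+ 1)) ℤ.* + suc n ∣ * suc d-1 ≡⟨ cong (_* suc d-1) numerator ⟩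
    ∣ c * B - suc n ∣ * suc d-1   ≡⟨ *-comm _ (suc d-1) ⟩
    suc d-1 * ∣ c * B - suc n ∣   <⟨ close ⟩
    suc n                         ≤⟨ m≤m*n (suc n) B ⟩
    suc n * B                     ≤⟨ m≤n*m (suc n * B) (suc a) ⟩
    suc a * (suc n * B)           ∎
distance-< c n B (mkℚ (+ 0) d-1 _)    (*<* (+<+ ())) close
distance-< c n B (mkℚ -[1+ _ ] d-1 _) (*<* ()) close

sampled-normal : ∀ {b-1} (k ℓ : ℕ) → 2 ≤ ℓ → Normal (suc b-1) (λ j → doubled (k + j * ℓ))
sampled-normal {b-1} k ℓ 2≤ℓ w _ ds ε 0<ε = proj₁ small , λ m N≤m →
  distance-< (count c ds (suc m)) m (suc b-1 ^ w) {{m^n≢0 (suc b-1) w}} ε 0<ε (close m N≤m)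
  where
  c = sampled k ℓ 2≤ℓ ds
  d = ℚ.↧ₙ ε
  -- The factor 4 beats the 3 in the bound and makes the final inequality strict.
  small = discrepancy-small k ℓ 2≤ℓ ds (4 * d)
  open ≤-Reasoning
  close : ∀ m → proj₁ small ≤ m → d * ∣ count c ds (suc m) * suc b-1 ^ w - suc m ∣ < suc m
  close m N≤m = *-cancelˡ-< 4 _ _ (begin-strict
    4 * (d * ∣ count c ds (suc m) * suc b-1 ^ w - suc m ∣) ≡⟨ *-assoc 4 d _ ⟨
    4 * d * ∣ count c ds (suc m) * suc b-1 ^ w - suc m ∣
      ≡⟨ cong (λ z → 4 * d * ∣ z * suc b-1 ^ w - suc m ∣) (count≡∑ c ds (suc m)) ⟩
    4 * d * discrepancy k ℓ 2≤ℓ ds (suc m)  ≤⟨ proj₂ small (suc m) (m≤n⇒m≤1+n N≤m) ⟩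
    3 * suc m                               <⟨ *-monoˡ-< (suc m) (n<1+n 3) ⟩
    4 * suc m                               ∎)

-- Non-normality of the doubled sequence

half-repeats : ∀ i → ⌊ i /2⌋ ≡ ⌊ suc i /2⌋ ⊎ ⌊ suc i /2⌋ ≡ ⌊ suc (suc i) /2⌋
half-repeats zero          = inj₁ refl
half-repeats (suc zero)    = inj₂ refl
half-repeats (suc (suc i)) with half-repeats i
... | inj₁ eq = inj₁ (cong suc eq)
... | inj₂ eq = inj₂ (cong suc eq)

ded-never-occurs : ∀ {b} {d e : Fin b} (c : Digits b) → d ≢ e → ∀ i →
  c i ≡ c (suc i) ⊎ c (suc i) ≡ c (suc (suc i)) → occursAt c (d ∷ e ∷ d ∷ []) i ≡ false
ded-never-occurs {d = d} {e} c d≢e i rep with c i ≟F d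
... | no  _  = refl
... | yes c₀ with c (suc i) ≟F e
...   | no  _  = refl
...   | yes c₁ with c (suc (suc i)) ≟F d
...     | no  _  = refl
...     | yes c₂ with rep
...       | inj₁ eq = ⊥-elim (d≢e (trans (sym c₀) (trans eq c₁)))
...       | inj₂ eq = ⊥-elim (d≢e (trans (sym c₂) (trans (sym eq) c₁)))

count-never : ∀ {b w} (c : Digits b) (ds : Vec (Fin b) w) → (∀ i → occursAt c ds i ≡ false) → ∀ n → count c ds n ≡ 0
count-never c ds never zero    = refl
count-never c ds never (suc n) rewrite never n = count-never c ds never n

never⇒¬normal : ∀ {b-1 w} (c : Digits (suc b-1)) (ds : Vec (Fin (suc b-1)) (suc w)) →
  (∀ i → occursAt c ds i ≡ false) → ¬ Normal (suc b-1) c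
never⇒¬normal {b-1} {w} c ds never normal = ℚ.<-irrefl ∣freq-L∣≡L (proj₂ limit N (≤-refl))
  where
  instance
    _ = m^n≢0 (suc b-1) (suc w)
    _ = ℚ.normalize-pos 1 (suc b-1 ^ suc w)
  L = invPow (suc b-1) (suc w)
  0<L : 0ℚ <ℚ L
  0<L = ℚ.positive⁻¹ L
  -- The limit itself serves as tolerance: a frequency that is always 0 stays at distance exactly
  -- `L`, which is not below `L`.
  limit = normal (suc w) (s≤s z≤n) ds L 0<L
  N = proj₁ limit
  open ≡-Reasoning
  ∣freq-L∣≡L : ℚ.∣ freq c ds N ℚ.- L ∣ ≡ L
  ∣freq-L∣≡L = begin
    ℚ.∣ freq c ds N ℚ.- L ∣           ≡⟨ cong (λ z → ℚ.∣ (+ z) ℚ./ suc N ℚ.- L ∣) (count-never c ds never (suc N)) ⟩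
    ℚ.∣ (+ 0) ℚ./ suc N ℚ.- L ∣       ≡⟨ cong (λ z → ℚ.∣ z ℚ.- L ∣) (ℚ.0/n≡0 (suc N)) ⟩
    ℚ.∣ 0ℚ ℚ.- L ∣                    ≡⟨ cong ℚ.∣_∣ (ℚ.+-identityˡ (ℚ.- L)) ⟩
    ℚ.∣ ℚ.- L ∣                       ≡⟨ ℚ.∣-p∣≡∣p∣ L ⟩
    ℚ.∣ L ∣                           ≡⟨ ℚ.0≤p⇒∣p∣≡p (ℚ.<⇒≤ 0<L) ⟩
    L                                 ∎

theorem1p1 : (b : ℕ) → 2 ≤ b →
    Σ (Digits b) (λ a →
    ¬ Normal b a ×
    (∀ (k ℓ : ℕ) → 2 ≤ ℓ → Normal b (λ j → a (k + j * ℓ))))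
theorem1p1 (suc (suc b)) (s≤s (s≤s z≤n)) =
    doubled
  -- The missing block is 0 1 0; `2 ≤ b` provides the two distinct digits.
  , never⇒¬normal doubled (zero ∷ suc zero ∷ zero ∷ []) (λ i → ded-never-occurs doubled (λ ()) i (repeats i))
  , sampled-normal
  where
  repeats : ∀ i → doubled i ≡ doubled (suc i) ⊎ doubled (suc i) ≡ doubled (suc (suc i))
  repeats i with half-repeats i
  ... | inj₁ eq = inj₁ (cong x eq)
  ... | inj₂ eq = inj₂ (cong x eq)
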